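{- Let $t$ be an integer with $t\geq 8$. Then $$\operatorname{gr}_4(P_5:PA_{t,5})=4t-3 .$$
   Context: All graphs are finite, simple and undirected. $K_n$ is the complete graph on $n$ vertices and $P_5$ is the path with $5$ vertices and $4$ edges. For $t\geq\omega+1$, the pineapple $PA_{t,\omega}$ is the graph of order $t$ obtained from the complete graph $K_\omega$ by attaching $t-\omega$ pendent vertices to one and the same vertex of $K_\omega$. A $k$-edge-coloring assigns to each edge one of $k$ colors; all $k$-edge-colorings are assumed exact, i.e. each of the $k$ colors is used at least once. An edge-colored graph is rainbow if all its edges have different colors and monochromatic if all its edges have a single color. A copy of a graph means a (not necessarily induced) subgraph isomorphic to it. For non-empty graphs $G,H$ (graphs with at least one edge) and a positive integer $k$, the Gallai-Ramsey number $\operatorname{gr}_k(G:H)$ is the minimum integer $N$ with $\binom{N}{2}\geq k$ (so that $K_N$ admits a $k$-edge-coloring) such that for all $n\geq N$, every $k$-edge-coloring of $K_n$ contains either a rainbow copy of $G$ or a monochromatic copy of $H$. -}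

module Defs where

open import Level using (0ℓ)
open import Data.Nat using (ℕ; suc; _≤_; _<_; _≥_; _≟_; _<?_; NonZero)
open import Data.Nat.Combinatorics using (_C_)
open import Data.Nat.Properties using (1+n≢n)
open import Data.Fin using (Fin; toℕ)
import Data.Fin as Fin
open import Data.Product using (_×_; _,_; ∃; ∃₂; ∃-syntax; swap)
open import Data.Sum using (_⊎_; inj₁; inj₂)
import Data.Sum as Sum
open import Function.Definitions using (Injective)
open import Relation.Nullary using (¬?; _×-dec_; _⊎-dec_)
open import Relation.Binary using (Rel; Decidable; Symmetric; Irreflexive)
open import Relation.Binary.PropositionalEquality using (_≡_; _≢_; refl; ≢-sym)

record Graph (n : ℕ) : Set₁ where
  field
    Adj    : Rel (Fin n) 0ℓ
    sym    : Symmetric Adj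
    irrefl : Irreflexive _≡_ Adj
    adj?   : Decidable Adj

open Graph public using (Adj)

K : ∀ n → Graph n
K n = record
  { Adj    = _≢_
  ; sym    = ≢-sym
  ; irrefl = λ p q → q p
  ; adj?   = λ u v → ¬? (u Fin.≟ v)
  }

-- The path with n vertices (and n ∸ 1 edges).
P : ∀ n → Graph n
P n = record
  { Adj    = λ u v → suc (toℕ u) ≡ toℕ v ⊎ suc (toℕ v) ≡ toℕ u
  ; sym    = Sum.swap
  ; irrefl = λ { refl (inj₁ e) → 1+n≢n e ; refl (inj₂ e) → 1+n≢n e }
  ; adj?   = λ u v → (suc (toℕ u) ≟ toℕ v) ⊎-dec (suc (toℕ v) ≟ toℕ u)
  }

-- The pineapple: the vertices numbered below ω form the clique, and each of
-- the t ∸ ω remaining vertices is attached to vertex 0 only.  This is the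
-- intended graph when 1 ≤ ω and ω + 1 ≤ t.
PA : ∀ t (ω : ℕ) → Graph t
PA t ω = record
  { Adj    = λ u v → u ≢ v ×
               ((toℕ u < ω × toℕ v < ω) ⊎ (toℕ u ≡ 0 ⊎ toℕ v ≡ 0))
  ; sym    = λ { (u≢v , e) → ≢-sym u≢v , Sum.map swap Sum.swap e }
  ; irrefl = λ { p (u≢v , _) → u≢v p }
  ; adj?   = λ u v → ¬? (u Fin.≟ v) ×-dec
               (((toℕ u <? ω) ×-dec (toℕ v <? ω)) ⊎-dec
                ((toℕ u ≟ 0) ⊎-dec (toℕ v ≟ 0)))
  }

-- An exact k-edge-coloring.  The color of a pair that is not an edge carries
-- no meaning: no definition below inspects it.
record EdgeColoring {n : ℕ} (H : Graph n) (k : ℕ) : Set where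
  field
    color : Fin n → Fin n → Fin k
    sym   : ∀ u v → color u v ≡ color v u
    exact : ∀ i → ∃₂ λ u v → Adj H u v × color u v ≡ i

open EdgeColoring public using (color)

-- A (not necessarily induced) subgraph of H isomorphic to G, given by the
-- isomorphism from G onto it.
record Copy {m n : ℕ} (G : Graph m) (H : Graph n) : Set where
  field
    vertex    : Fin m → Fin n
    injective : Injective _≡_ _≡_ vertex
    edge      : ∀ {a b} → Adj G a b → Adj H (vertex a) (vertex b)

open Copy public using (vertex)

module _ {m n k : ℕ} {G : Graph m} {H : Graph n} (c : EdgeColoring H k) where

  -- Edges with equal colors are equal as unordered pairs.
  Rainbow : Copy G H → Set
  Rainbow φ = ∀ {a b a′ b′} → Adj G a b → Adj G a′ b′ →
    color c (vertex φ a) (vertex φ b) ≡ color c (vertex φ a′) (vertex φ b′) →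
    (a ≡ a′ × b ≡ b′) ⊎ (a ≡ b′ × b ≡ a′)

  Monochromatic : Copy G H → Set
  Monochromatic φ = ∃[ i ] ∀ {a b} → Adj G a b →
    color c (vertex φ a) (vertex φ b) ≡ i

module _ (k : ℕ) .{{_ : NonZero k}} {l m : ℕ} (G : Graph l) (H : Graph m) where

  GallaiRamseyBound : ℕ → Set
  GallaiRamseyBound N = k ≤ N C 2 ×
    (∀ n → n ≥ N → (c : EdgeColoring (K n) k) →
      ∃ (Rainbow {G = G} c) ⊎ ∃ (Monochromatic {G = H} c))

  -- gr k (G : H) = N, expressed as a relation: N is the minimum bound.
  IsGallaiRamseyNumber : ℕ → Set
  IsGallaiRamseyNumber N =
    GallaiRamseyBound N × (∀ M → GallaiRamseyBound M → N ≤ M)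

{-# OPTIONS --safe #-}

-- Upper bound.  If some vertex y sees three colours, the three edges of a
-- rainbow claw at y together with an edge of the fourth colour span at most six
-- vertices S (after adding one vertex when the edge joins two leaves).  A finite
-- search over the colours inside S shows that, without a rainbow P₅, they
-- force one colour on all edges disjoint from S; these form a clique on at least
-- n − 6 ≥ t vertices.  If no vertex sees three colours, some colour d is seen at
-- every junction of two colours, so the vertices split into three classes with
-- only d between them and only d and an own colour inside each.  A clique K₅ of
-- colour d meeting two classes has a centre of degree at least n/2 in colour d.
-- Without such a clique, two of the classes are monochromatic cliques on fewer
-- than t vertices, and the third has at least 2t − 1 ≥ 15 ≥ R(3,5) vertices and no
-- triangle of colour d.  So it contains a K₅ in its own colour, and a vertex of it
-- has degree at least t − 1 in that colour, or else at least t neighbours in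
-- colour d in its class, which form a clique in the own colour.
--
-- Lower bound.  Four blocks of t − 1 vertices, colour 0 between blocks and one
-- further colour inside each block, using all three of them.

module Submission where

open import Data.Bool using (Bool; true; false; T; _∨_; _∧_; if_then_else_)
open import Data.Bool.ListAction using (all; any)
open import Data.Bool.Properties using (T-∨; T-∧; T-≡)
open import Data.Fin using (Fin; zero; suc; toℕ; inject≤; inject₁; combine; quotient; remainder; _≟_)
open import Data.Fin.Patterns using (0F; 1F; 2F; 3F; 4F; 5F)
open import Data.Fin.Properties
  using (any?; injective⇒≤; inject≤-injective; toℕ-inject≤; toℕ-injective; toℕ<n;
         pigeonhole; remQuot-combine; combine-remQuot)
  renaming (<⇒≢ to <⇒≢ᶠ)
open import Data.List
  using (List; []; _∷_; _++_; length; lookup; filter; allFin; take; map; reverse; concatMap)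
open import Data.List.Properties using (length-++; length-tabulate; length-take)
import Data.List.Membership.DecPropositional as DecMembership
open import Data.List.Membership.Propositional using (_∈_; _∉_)
open import Data.List.Membership.Propositional.Properties
  using (∈-lookup; ∈-allFin; ∈-filter⁺; ∈-filter⁻; ∈-++⁺ˡ; ∈-++⁺ʳ; ∈-++⁻)
open import Data.List.Membership.Setoid.Properties using (index-injective)
open import Data.List.Relation.Binary.Subset.Propositional using (_⊆_)
open import Data.List.Relation.Unary.All as All using (All; []; _∷_)
open import Data.List.Relation.Unary.All.Properties using (all⁺)
open import Data.List.Relation.Unary.AllPairs as AllPairs using (AllPairs; []; _∷_)
import Data.List.Relation.Unary.AllPairs.Properties as AllPairs
open import Data.List.Relation.Unary.Any as Any using (here; there)
open import Data.List.Relation.Unary.Any.Properties using (any⁻; lookup-index)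
open import Data.List.Relation.Unary.Unique.DecPropositional using (unique?)
open import Data.List.Relation.Unary.Unique.Propositional using (Unique)
import Data.List.Relation.Unary.Unique.Propositional.Properties as Unique
open import Data.Maybe using (Maybe; just; nothing)
open import Data.Maybe.Properties using (just-injective)
open import Data.Nat using (ℕ; zero; suc; pred; _+_; _*_; _∸_; _≤_; _<_; z≤n; s≤s; _≤?_)
open import Data.Nat.Combinatorics using (_C_; nC1≡n; nCk+nC[k+1]≡[n+1]C[k+1])
open import Data.Nat.Properties hiding (_≟_)
open import Data.Product using (_×_; _,_; ∃; ∃₂; proj₁; proj₂)
open import Data.Sum using (_⊎_; inj₁; inj₂; [_,_]′)
open import Data.Vec as Vec using (Vec; []; _∷_)
open import Data.Vec.Properties using (lookup-map; lookup-replicate; lookup∘updateAt; lookup∘updateAt′)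
open import Function using (_∘_; Equivalence)
open import Function.Definitions using (Injective)
open import Relation.Binary using (Rel; Symmetric)
open import Relation.Binary.PropositionalEquality
  using (_≡_; _≢_; refl; sym; trans; cong; cong₂; subst; setoid; ≢-sym)
open import Relation.Nullary using (Dec; yes; no; does; isYes; ¬_; ¬?; _×-dec_; contradiction)
open import Relation.Nullary.Decidable using (toWitness)
open import Defs

-- Lists without repetition, and counting by inclusion.

AllPairs-lookup : ∀ {a ℓ} {A : Set a} {R : Rel A ℓ} → Symmetric R → ∀ {xs} → AllPairs R xs →
  ∀ {i j} → i ≢ j → R (lookup xs i) (lookup xs j)
AllPairs-lookup s (_ ∷ _)  {zero}  {zero}  i≢j = contradiction refl i≢j
AllPairs-lookup s (p ∷ _)  {zero}  {suc j} _   = All.lookup p (∈-lookup j)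
AllPairs-lookup s (p ∷ _)  {suc i} {zero}  _   = s (All.lookup p (∈-lookup i))
AllPairs-lookup s (_ ∷ ps) {suc i} {suc j} i≢j = AllPairs-lookup s ps (i≢j ∘ cong suc)

AllPairs-∈ : ∀ {a ℓ} {A : Set a} {R : Rel A ℓ} → Symmetric R → ∀ {xs} → AllPairs R xs →
  ∀ {x y} → x ∈ xs → y ∈ xs → x ≢ y → R x y
AllPairs-∈ s (_ ∷ _)  (here refl) (here refl) x≢y = contradiction refl x≢y
AllPairs-∈ s (p ∷ _)  (here refl) (there y∈)  _   = All.lookup p y∈
AllPairs-∈ s (p ∷ _)  (there x∈)  (here refl) _   = s (All.lookup p x∈)
AllPairs-∈ s (_ ∷ ps) (there x∈)  (there y∈)  x≢y = AllPairs-∈ s ps x∈ y∈ x≢y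

lookup-++-∈ : ∀ {a} {A : Set a} (xs {ys} : List A) (i : Fin (length (xs ++ ys))) →
  toℕ i < length xs → lookup (xs ++ ys) i ∈ xs
lookup-++-∈ (x ∷ xs) zero    _       = here refl
lookup-++-∈ (x ∷ xs) (suc i) (s≤s p) = there (lookup-++-∈ xs i p)

take-⊆ : ∀ {a} {A : Set a} m {xs : List A} → take m xs ⊆ xs
take-⊆ (suc m) {_ ∷ _} (here eq)  = here eq
take-⊆ (suc m) {_ ∷ _} (there x∈) = there (take-⊆ m x∈)

∉⇒All≢ : ∀ {a} {A : Set a} {x : A} {xs} → x ∉ xs → All (x ≢_) xs
∉⇒All≢ x∉ = All.tabulate λ { y∈ refl → x∉ y∈ }

∷-unique : ∀ {a} {A : Set a} {x : A} {xs} → x ∉ xs → Unique xs → Unique (x ∷ xs)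
∷-unique x∉ xs! = ∉⇒All≢ x∉ ∷ xs!

lookup-injective : ∀ {a} {A : Set a} {xs : List A} → Unique xs → Injective _≡_ _≡_ (lookup xs)
lookup-injective xs! {i} {j} eq with i ≟ j
... | yes i≡j = i≡j
... | no i≢j  = contradiction eq (AllPairs-lookup ≢-sym xs! i≢j)

-- Sending each position in `xs` to a position of the same element in `ys` is injective.
length-mono-⊆ : ∀ {a} {A : Set a} {xs ys : List A} → Unique xs → xs ⊆ ys → length xs ≤ length ys
length-mono-⊆ {xs = xs} xs! xs⊆ys = injective⇒≤ {f = Any.index ∘ xs⊆ys ∘ ∈-lookup}
  (lookup-injective xs! ∘ index-injective (setoid _) (xs⊆ys (∈-lookup _)) (xs⊆ys (∈-lookup _)))

length-split : ∀ {a} {A : Set a} {xs ys zs : List A} → Unique xs → (∀ {x} → x ∈ xs → x ∈ ys ⊎ x ∈ zs) →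
  length xs ≤ length ys + length zs
length-split {ys = ys} {zs} xs! split = ≤-trans
  (length-mono-⊆ xs! λ x∈ → [ ∈-++⁺ˡ , ∈-++⁺ʳ ys ]′ (split x∈)) (≤-reflexive (length-++ ys))

module _ {n : ℕ} where

  open DecMembership (_≟_ {n}) public using (_∈?_)

  allFin! : Unique (allFin n)
  allFin! = Unique.allFin⁺ n

  length-allFin : length (allFin n) ≡ n
  length-allFin = length-tabulate _

  -- Abstract because abstracting over `fresh xs p` with `with` would unfold it.
  abstract

    complete : ∀ {xs : List (Fin n)} → Unique xs → n ≤ length xs → ∀ x → x ∈ xs
    complete {xs} xs! n≤ x with x ∈? xs
    ... | yes x∈ = x∈
    ... | no x∉  = contradiction (≤-trans
      (length-mono-⊆ (∷-unique x∉ xs!) (λ {y} _ → ∈-allFin y))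
      (≤-trans (≤-reflexive length-allFin) n≤)) 1+n≰n

    fresh : ∀ (xs : List (Fin n)) → length xs < n → ∃ (_∉ xs)
    fresh xs xs<n with any? (λ x → ¬? (x ∈? xs))
    ... | yes found = found
    ... | no none   = contradiction (≤-trans xs<n (≤-trans (≤-reflexive (sym length-allFin))
      (length-mono-⊆ allFin! λ {x} _ → member x))) 1+n≰n
      where
      member : ∀ x → x ∈ xs
      member x with x ∈? xs
      ... | yes x∈ = x∈
      ... | no x∉  = contradiction (x , x∉) none

-- Monochromatic cliques, neighbourhoods and pineapples.

module _ {n k : ℕ} (c : EdgeColoring (K n) k) where

  private
    χ = color c
    χ-sym = EdgeColoring.sym c

  Edge : Fin k → Rel (Fin n) _
  Edge i x y = x ≢ y × χ x y ≡ i

  edge? : ∀ i x y → Dec (Edge i x y)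
  edge? i x y = ¬? (x ≟ y) ×-dec (χ x y ≟ i)

  edge-sym : ∀ {i} → Symmetric (Edge i)
  edge-sym (x≢y , eq) = ≢-sym x≢y , trans (χ-sym _ _) eq

  Clique : Fin k → List (Fin n) → Set
  Clique i = AllPairs (Edge i)

  clique! : ∀ {i xs} → Clique i xs → Unique xs
  clique! = AllPairs.map proj₁

  neighbours : Fin k → Fin n → List (Fin n)
  neighbours i x = filter (edge? i x) (allFin n)

  neighbours! : ∀ i x → Unique (neighbours i x)
  neighbours! i x = Unique.filter⁺ (edge? i x) allFin!

  ∈-neighbours : ∀ {i x y} → Edge i x y → y ∈ neighbours i x
  ∈-neighbours {i} {x} = ∈-filter⁺ (edge? i x) (∈-allFin _)

  edge-neighbours : ∀ {i x y} → y ∈ neighbours i x → Edge i x y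
  edge-neighbours {i} {x} y∈ = proj₂ (∈-filter⁻ (edge? i x) {xs = allFin n} y∈)

  -- The list follows the numbering of `PA`: the hub `x`, the rest of the clique, then pendent
  -- vertices. Its first `t` entries are the copy.
  pineapple : ∀ {i x ks rest t} → Unique (x ∷ ks ++ rest) → Clique i (x ∷ ks) → All (Edge i x) rest →
    t ≤ length (x ∷ ks ++ rest) → ∃ (Monochromatic {G = PA t (length (x ∷ ks))} c)
  pineapple {i} {x} {ks} {rest} {t} xs! (spokes ∷ ks-clique) spokes′ t≤ = record
    { vertex    = vertex′
    ; injective = λ {a} {b} → injective′ {a} {b}
    ; edge      = λ (a≢b , _) → a≢b ∘ injective′
    } , i , λ {a} {b} → mono a b
    where
    xs = x ∷ ks ++ rest

    vertex′ : Fin t → Fin n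
    vertex′ a = lookup xs (inject≤ a t≤)

    injective′ : Injective _≡_ _≡_ vertex′
    injective′ = inject≤-injective t≤ t≤ _ _ ∘ lookup-injective xs!

    inner : ∀ a → toℕ a < suc (length ks) → vertex′ a ∈ x ∷ ks
    inner a a< = lookup-++-∈ (x ∷ ks) (inject≤ a t≤) (subst (_< _) (sym (toℕ-inject≤ a t≤)) a<)

    hub : ∀ a → toℕ a ≡ 0 → vertex′ a ≡ x
    hub a a≡0 = cong (lookup xs) (toℕ-injective {j = zero} (trans (toℕ-inject≤ a t≤) a≡0))

    spoke : ∀ y → y ∈ xs → y ≢ x → Edge i x y
    spoke y (here y≡x)   y≢x = contradiction y≡x y≢x
    spoke y (there y∈) _ with ∈-++⁻ ks y∈
    ... | inj₁ y∈ks   = All.lookup spokes y∈ks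
    ... | inj₂ y∈rest = All.lookup spokes′ y∈rest

    mono : ∀ a b → Adj (PA t (suc (length ks))) a b → χ (vertex′ a) (vertex′ b) ≡ i
    mono a b (a≢b , inj₁ (a< , b<)) =
      proj₂ (AllPairs-∈ edge-sym (spokes ∷ ks-clique) (inner a a<) (inner b b<) (a≢b ∘ injective′))
    mono a b (a≢b , inj₂ (inj₁ a≡0)) = trans (cong (λ z → χ z (vertex′ b)) (hub a a≡0))
      (proj₂ (spoke (vertex′ b) (∈-lookup (inject≤ b t≤)) (λ eq → a≢b (sym (injective′ (trans eq (sym (hub a a≡0))))))))
    mono a b (a≢b , inj₂ (inj₂ b≡0)) = trans (χ-sym _ _) (mono b a (≢-sym a≢b , inj₂ (inj₁ b≡0)))

  -- All neighbours of `x` outside `ks` become pendent vertices, so the list has at least one entry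
  -- more than `x` has neighbours.
  clique⇒pineapple : ∀ {i x ks t} → Clique i (x ∷ ks) → t ≤ suc (length (neighbours i x)) →
    ∃ (Monochromatic {G = PA t (length (x ∷ ks))} c)
  clique⇒pineapple {i} {x} {ks} {t} clique@(spokes ∷ ks-clique) t≤ =
    pineapple ((All.tabulate x∉ ∷ Unique.++⁺ (clique! ks-clique) rest! disjoint)) clique
      (All.tabulate (edge-neighbours ∘ proj₁ ∘ ∈-filter⁻ outside?)) (≤-trans t≤ (s≤s (length-mono-⊆ (neighbours! i x) covered)))
    where
    outside? = λ y → ¬? (y ∈? ks)
    rest = filter outside? (neighbours i x)

    rest! : Unique rest
    rest! = Unique.filter⁺ outside? (neighbours! i x)

    disjoint : ∀ {y} → ¬ (y ∈ ks × y ∈ rest)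
    disjoint (y∈ks , y∈rest) = proj₂ (∈-filter⁻ outside? {xs = neighbours i x} y∈rest) y∈ks

    x∉ : ∀ {y} → y ∈ ks ++ rest → x ≢ y
    x∉ y∈ with ∈-++⁻ ks y∈
    ... | inj₁ y∈ks   = proj₁ (All.lookup spokes y∈ks)
    ... | inj₂ y∈rest = proj₁ (edge-neighbours (proj₁ (∈-filter⁻ outside? {xs = neighbours i x} y∈rest)))

    covered : neighbours i x ⊆ ks ++ rest
    covered {y} y∈ with y ∈? ks
    ... | yes y∈ks = ∈-++⁺ˡ y∈ks
    ... | no y∉ks  = ∈-++⁺ʳ ks (∈-filter⁺ outside? y∈ y∉ks)

  -- Only `suc ω` vertices are kept as the clique part; the hub stays joined in colour `i` to all
  -- the others, which gives it degree at least t - 1.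
  large-clique⇒pineapple : ∀ {i xs t ω} → Clique i xs → suc ω ≤ t → t ≤ length xs →
    ∃ (Monochromatic {G = PA t (suc ω)} c)
  large-clique⇒pineapple {i} {x ∷ ks} {t} {ω} clique@(spokes ∷ ks-clique) ω<t t≤ =
    subst (λ ω → ∃ (Monochromatic {G = PA t (suc ω)} c))
      (trans (length-take ω ks) (m≤n⇒m⊓n≡m (≤-pred (≤-trans ω<t t≤))))
      (clique⇒pineapple (AllPairs.take⁺ (suc ω) clique)
        (≤-trans t≤ (s≤s (length-mono-⊆ (clique! ks-clique) (∈-neighbours ∘ All.lookup spokes)))))
  large-clique⇒pineapple {xs = []} _ ω<t t≤ = contradiction (≤-trans ω<t t≤) λ ()

-- R(3,s) ≤ triangular s: the neighbours of a vertex in the triangle-free colour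
-- form a clique in the other colour, whence R(3,s+1) ≤ R(3,s) + s + 1.
triangular : ℕ → ℕ
triangular zero    = 0
triangular (suc s) = suc s + triangular s

module _ {n k : ℕ} (c : EdgeColoring (K n) k) where

  private
    χ = color c
    χ-sym = EdgeColoring.sym c

  clique-from : ∀ {i xs} → Unique xs → (∀ {x y} → x ∈ xs → y ∈ xs → x ≢ y → χ x y ≡ i) → Clique c i xs
  clique-from [] _ = []
  clique-from (x∉ ∷ xs!) h =
    All.tabulate (λ y∈ → All.lookup x∉ y∈ , h (here refl) (there y∈) (All.lookup x∉ y∈)) ∷
    clique-from xs! (λ x∈ y∈ → h (there x∈) (there y∈))

  ramsey : ∀ {r b} s (xs : List (Fin n)) → Unique xs →
    (∀ {x y} → x ∈ xs → y ∈ xs → x ≢ y → χ x y ≡ r ⊎ χ x y ≡ b) →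
    (∀ {x y z} → x ∈ xs → y ∈ xs → z ∈ xs → ¬ Clique c r (x ∷ y ∷ z ∷ [])) →
    triangular s ≤ length xs → ∃ λ ks → length ks ≡ s × ks ⊆ xs × Clique c b ks
  ramsey zero xs _ _ _ _ = [] , refl , (λ ()) , []
  ramsey {r} {b} (suc s) (x ∷ xs) (x∉ ∷ xs!) two-coloured triangle-free (s≤s size)
    with suc s ≤? length (filter (edge? c r x) xs)
  ... | yes large = take (suc s) red , trans (length-take (suc s) red) (m≤n⇒m⊓n≡m large) ,
      (λ y∈ → there (red⊆ (take-⊆ (suc s) y∈))) , AllPairs.take⁺ (suc s) red-clique
    where
    red = filter (edge? c r x) xs

    red⊆ : red ⊆ xs
    red⊆ y∈ = proj₁ (∈-filter⁻ (edge? c r x) y∈)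

    red-clique : Clique c b red
    red-clique = clique-from (Unique.filter⁺ (edge? c r x) xs!) λ {y} {z} y∈ z∈ y≢z →
      let y∈xs , xy = ∈-filter⁻ (edge? c r x) y∈
          z∈xs , xz = ∈-filter⁻ (edge? c r x) z∈
      in [ (λ yz → contradiction ((xy ∷ xz ∷ []) ∷ ((y≢z , yz) ∷ []) ∷ [] ∷ [])
                                 (triangle-free (here refl) (there y∈xs) (there z∈xs)))
         , (λ yz → yz) ]′ (two-coloured (there y∈xs) (there z∈xs) y≢z)
  ... | no small =
    let ks , len , ks⊆ , clique = ramsey s blue (Unique.filter⁺ red? xs!)
          (λ y∈ z∈ → two-coloured (there (blue⊆ y∈)) (there (blue⊆ z∈)))
          (λ y∈ z∈ w∈ → triangle-free (there (blue⊆ y∈)) (there (blue⊆ z∈)) (there (blue⊆ w∈)))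
          enough
    in x ∷ ks , cong suc len
     , (λ { (here eq) → here eq ; (there y∈) → there (blue⊆ (ks⊆ y∈)) })
     , All.tabulate (spoke ∘ ks⊆) ∷ clique
    where
    red? = ¬? ∘ edge? c r x
    blue = filter red? xs

    blue⊆ : blue ⊆ xs
    blue⊆ y∈ = proj₁ (∈-filter⁻ red? y∈)

    spoke : ∀ {y} → y ∈ blue → Edge c b x y
    spoke y∈ with ∈-filter⁻ red? {xs = xs} y∈
    ... | y∈xs , ¬red = All.lookup x∉ y∈xs ,
      [ (λ xy → contradiction (All.lookup x∉ y∈xs , xy) ¬red) , (λ xy → xy) ]′
        (two-coloured (here refl) (there y∈xs) (All.lookup x∉ y∈xs))

    split : ∀ {y} → y ∈ xs → y ∈ filter (edge? c r x) xs ⊎ y ∈ blue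
    split {y} y∈ with edge? c r x y
    ... | yes xy = inj₁ (∈-filter⁺ (edge? c r x) y∈ xy)
    ... | no ¬xy = inj₂ (∈-filter⁺ red? y∈ ¬xy)

    -- Of the `suc s + triangular s` vertices, only `x` and at most `s` neighbours of colour `r` are
    -- lost.
    enough : triangular s ≤ length blue
    enough = +-cancelˡ-≤ s _ _ (≤-trans size (≤-trans (length-split xs! split)
      (+-monoˡ-≤ _ (≤-pred (≰⇒> small)))))

-- Colourings with one colour `d` between all classes; `s` stands for t - 1.

module Dominated {n k s : ℕ} (c : EdgeColoring (K n) k) (7≤s : 7 ≤ s) (large : suc (4 * s) ≤ n)
  (d : Fin k) (ℓ : Fin n → Fin k)
  (two-coloured : ∀ {u v} → u ≢ v → color c u v ≡ d ⊎ (color c u v ≡ ℓ u × color c u v ≡ ℓ v)) where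

  private
    Goal = ∃ (Monochromatic {G = PA (suc s) 5} c)

  large′ : suc (s + s + (s + s)) ≤ n
  large′ = ≤-trans (≤-reflexive (cong suc (trans (+-assoc s s (s + s))
    (cong (λ m → s + (s + (s + m))) (sym (+-identityʳ s)))))) large

  cross : ∀ {u v} → ℓ u ≢ ℓ v → Edge c d u v
  cross ℓu≢ℓv = (λ { refl → ℓu≢ℓv refl }) ,
    [ (λ eq → eq) , (λ (p , q) → contradiction (trans (sym p) q) ℓu≢ℓv) ]′ (two-coloured (λ { refl → ℓu≢ℓv refl }))

  -- Every vertex differs in label from `u` or from `v`, hence is a neighbour of one of them in
  -- colour `d`. Their degrees add up to at least n, so one of the two can serve as hub.
  mixed-clique : ∀ {u v x y z} → ℓ u ≢ ℓ v → Clique c d (u ∷ v ∷ x ∷ y ∷ z ∷ []) → Goal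
  mixed-clique {u} {v} ℓu≢ℓv clique@((uv ∷ u-) ∷ v- ∷ rest) with suc s ≤? suc (length (neighbours c d u))
  ... | yes u-large = clique⇒pineapple c clique u-large
  ... | no u-small  = clique⇒pineapple c ((edge-sym c uv ∷ v-) ∷ u- ∷ rest) (s≤s v-large)
    where
    split : ∀ {w} → w ∈ allFin n → w ∈ neighbours c d u ⊎ w ∈ neighbours c d v
    split {w} _ with ℓ u ≟ ℓ w
    ... | no ℓu≢ℓw = inj₁ (∈-neighbours c (cross ℓu≢ℓw))
    ... | yes ℓu≡ℓw = inj₂ (∈-neighbours c (cross (λ ℓv≡ℓw → ℓu≢ℓv (trans ℓu≡ℓw (sym ℓv≡ℓw)))))

    v-large : s ≤ length (neighbours c d v)
    v-large = +-cancelˡ-≤ s _ _ (≤-trans (≤-trans (m≤m+n (s + s) (s + s)) (≤-trans (n≤1+n _) large′))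
      (≤-trans (≤-reflexive (sym length-allFin)) (≤-trans (length-split allFin! split)
        (+-monoˡ-≤ _ (≤-pred (≤-trans (n≤1+n _) (≰⇒> u-small)))))))

  part : Fin k → List (Fin n)
  part i = filter (λ v → ℓ v ≟ i) (allFin n)

  part! : ∀ i → Unique (part i)
  part! i = Unique.filter⁺ _ allFin!

  ∈-part : ∀ {v i} → ℓ v ≡ i → v ∈ part i
  ∈-part = ∈-filter⁺ _ (∈-allFin _)

  part-label : ∀ {v i} → v ∈ part i → ℓ v ≡ i
  part-label {i = i} v∈ = proj₂ (∈-filter⁻ (λ v → ℓ v ≟ i) {xs = allFin n} v∈)

  Mixed : Fin k → Set
  Mixed i = ∃₂ λ x y → ℓ x ≡ i × ℓ y ≡ i × Edge c d x y

  mixed? : ∀ i → Dec (Mixed i)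
  mixed? i = any? λ x → any? λ y → (ℓ x ≟ i) ×-dec (ℓ y ≟ i) ×-dec edge? c d x y

  cross′ : ∀ {u v i j} → i ≢ j → ℓ u ≡ i → ℓ v ≡ j → Edge c d u v
  cross′ i≢j refl refl = cross i≢j

  -- An edge of colour `d` from each of the two classes, together with `v` from outside both, spans
  -- a K₅ of colour `d`.
  two-mixed : ∀ {i j v} → i ≢ j → ℓ v ≢ i → ℓ v ≢ j → Mixed i → Mixed j → Goal
  two-mixed i≢j ℓv≢i ℓv≢j (x , x′ , refl , x′∈ , xx′) (y , y′ , refl , y′∈ , yy′) =
    mixed-clique i≢j
      ( (cross i≢j ∷ xx′ ∷ cross′ i≢j refl y′∈ ∷ cross (≢-sym ℓv≢i) ∷ [])
      ∷ (cross′ (≢-sym i≢j) refl x′∈ ∷ yy′ ∷ cross (≢-sym ℓv≢j) ∷ [])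
      ∷ (cross′ i≢j x′∈ y′∈ ∷ cross′ (≢-sym ℓv≢i) x′∈ refl ∷ [])
      ∷ (cross′ (≢-sym ℓv≢j) y′∈ refl ∷ []) ∷ [] ∷ [])

  -- The vertices `v` and `w` of two further classes complete the triangle to a K₅ of colour `d`.
  triangle : ∀ {i x y z v w} → ℓ v ≢ i → ℓ w ≢ i → ℓ v ≢ ℓ w → ℓ x ≡ i → ℓ y ≡ i → ℓ z ≡ i →
    Clique c d (x ∷ y ∷ z ∷ []) → Goal
  triangle ℓv≢i ℓw≢i ℓv≢ℓw x∈ y∈ z∈ ((xy ∷ xz ∷ []) ∷ (yz ∷ []) ∷ [] ∷ []) =
    mixed-clique (λ eq → ℓv≢i (trans (sym eq) x∈))
      ( (cross′ (≢-sym ℓv≢i) x∈ refl ∷ xy ∷ xz ∷ cross′ (≢-sym ℓw≢i) x∈ refl ∷ [])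
      ∷ (cross′ ℓv≢i refl y∈ ∷ cross′ ℓv≢i refl z∈ ∷ cross ℓv≢ℓw ∷ [])
      ∷ (yz ∷ cross′ (≢-sym ℓw≢i) y∈ refl ∷ [])
      ∷ (cross′ (≢-sym ℓw≢i) z∈ refl ∷ []) ∷ [] ∷ [])

  pure-clique : ∀ {i} → ¬ Mixed i → Clique c i (part i)
  pure-clique {i} pure = clique-from c (part! i) λ x∈ y∈ x≢y →
    [ (λ xy → contradiction (_ , _ , part-label x∈ , part-label y∈ , x≢y , xy) pure)
    , (λ (xy , _) → trans xy (part-label x∈)) ]′ (two-coloured x≢y)

  5≤t : 5 ≤ suc s
  5≤t = s≤s (≤-trans (m≤m+n 4 3) 7≤s)

  two-pure : ∀ {i v w} → (∀ u → ℓ u ≡ i ⊎ ℓ u ≡ ℓ v ⊎ ℓ u ≡ ℓ w) → ℓ v ≢ i → ℓ w ≢ i → ℓ v ≢ ℓ w →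
    ¬ Mixed (ℓ v) → ¬ Mixed (ℓ w) → Goal
  two-pure {i} {v} {w} exhaustive ℓv≢i ℓw≢i ℓv≢ℓw v-pure w-pure
    with suc s ≤? length (part (ℓ v)) | suc s ≤? length (part (ℓ w))
       | any? (λ x → any? λ y → any? λ z → (ℓ x ≟ i) ×-dec (ℓ y ≟ i) ×-dec (ℓ z ≟ i)
           ×-dec AllPairs.allPairs? (edge? c d) (x ∷ y ∷ z ∷ []))
  ... | yes v-large | _ | _ = large-clique⇒pineapple c (pure-clique v-pure) 5≤t v-large
  ... | no _ | yes w-large | _ = large-clique⇒pineapple c (pure-clique w-pure) 5≤t w-large
  ... | no _ | no _ | yes (x , y , z , x∈ , y∈ , z∈ , xyz) = triangle ℓv≢i ℓw≢i ℓv≢ℓw x∈ y∈ z∈ xyz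
  ... | no v-small | no w-small | no triangle-free = own-clique
    (ramsey c 5 L (part! i) (λ x∈ y∈ x≢y → colours x∈ x≢y)
      (λ x∈ y∈ z∈ xyz → triangle-free (_ , _ , _ , part-label x∈ , part-label y∈ , part-label z∈ , xyz))
      -- By 7 ≤ s the class has at least 2s + 1 ≥ 15 = `triangular 5` vertices.
      (≤-trans (s≤s (+-mono-≤ 7≤s 7≤s)) L-large))
    where
    L = part i

    colours : ∀ {x y} → x ∈ L → x ≢ y → color c x y ≡ d ⊎ color c x y ≡ i
    colours x∈ x≢y = [ inj₁ , (λ (xy , _) → inj₂ (trans xy (part-label x∈))) ]′ (two-coloured x≢y)

    split : ∀ {u} → u ∈ allFin n → u ∈ L ⊎ u ∈ part (ℓ v) ++ part (ℓ w)
    split {u} _ with exhaustive u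
    ... | inj₁ u∈         = inj₁ (∈-part u∈)
    ... | inj₂ (inj₁ u∈) = inj₂ (∈-++⁺ˡ (∈-part u∈))
    ... | inj₂ (inj₂ u∈) = inj₂ (∈-++⁺ʳ (part (ℓ v)) (∈-part u∈))

    others : length (part (ℓ v) ++ part (ℓ w)) ≤ s + s
    others = ≤-trans (≤-reflexive (length-++ (part (ℓ v))))
      (+-mono-≤ (≤-pred (≰⇒> v-small)) (≤-pred (≰⇒> w-small)))

    L-large : suc (s + s) ≤ length L
    L-large = +-cancelʳ-≤ (s + s) _ _ (≤-trans large′ (≤-trans (≤-reflexive (sym length-allFin))
      (≤-trans (length-split allFin! split) (+-monoʳ-≤ (length L) others))))

    own-clique : (∃ λ ks → length ks ≡ 5 × ks ⊆ L × Clique c i ks) → Goal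
    own-clique (x ∷ ks , len , ks⊆ , clique) with suc s ≤? length (filter (edge? c d x) L)
    ... | yes red-large = large-clique⇒pineapple c red-clique 5≤t red-large
      where
      red-clique : Clique c i (filter (edge? c d x) L)
      red-clique = clique-from c (Unique.filter⁺ (edge? c d x) (part! i)) λ y∈ z∈ y≢z →
        let y∈L , xy = ∈-filter⁻ (edge? c d x) y∈
            z∈L , xz = ∈-filter⁻ (edge? c d x) z∈
        in [ (λ yz → contradiction (_ , _ , _ , part-label (ks⊆ (here refl)) , part-label y∈L , part-label z∈L ,
                                     (xy ∷ xz ∷ []) ∷ ((y≢z , yz) ∷ []) ∷ [] ∷ []) triangle-free)
           , (λ yz → yz) ]′ (colours y∈L y≢z)
    -- Among the at least 2s + 1 vertices of the class, `x` and its neighbours in colour `d` take at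
    -- most s + 1; the other s = t - 1 are neighbours in the class's own colour.
    ... | no red-small = subst (λ ω → ∃ (Monochromatic {G = PA (suc s) ω} c)) len
        (clique⇒pineapple c clique (s≤s (+-cancelˡ-≤ (suc s) _ _ (≤-trans L-large
          (≤-trans (length-split {ys = x ∷ filter (edge? c d x) L} {zs = neighbours c i x} (part! i) split′)
            (+-monoˡ-≤ _ (≰⇒> red-small)))))))
      where
      split′ : ∀ {y} → y ∈ L → y ∈ x ∷ filter (edge? c d x) L ⊎ y ∈ neighbours c i x
      split′ {y} y∈ with x ≟ y
      ... | yes refl = inj₁ (here refl)
      ... | no x≢y   = [ (λ xy → inj₁ (there (∈-filter⁺ (edge? c d x) y∈ (x≢y , xy))))
                       , (λ xy → inj₂ (∈-neighbours c (x≢y , xy))) ]′ (colours (ks⊆ (here refl)) x≢y)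

  -- Among three classes, two contain an edge of colour `d` or two do not.
  dominated : ∀ {u v w} → Unique (ℓ u ∷ ℓ v ∷ ℓ w ∷ []) → (∀ x → ℓ x ∈ ℓ u ∷ ℓ v ∷ ℓ w ∷ []) → Goal
  dominated {u} {v} {w} ((u≢v ∷ u≢w ∷ []) ∷ (v≢w ∷ []) ∷ [] ∷ []) exhaustive
    with mixed? (ℓ u) | mixed? (ℓ v) | mixed? (ℓ w)
  ... | yes U | yes V | _     = two-mixed u≢v (≢-sym u≢w) (≢-sym v≢w) U V
  ... | yes U | no _  | yes W = two-mixed u≢w (≢-sym u≢v) v≢w U W
  ... | no _  | yes V | yes W = two-mixed v≢w u≢v u≢w V W
  ... | _     | no V  | no W  = two-pure cases (≢-sym u≢v) (≢-sym u≢w) v≢w V W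
    where
    cases : ∀ x → ℓ x ≡ ℓ u ⊎ ℓ x ≡ ℓ v ⊎ ℓ x ≡ ℓ w
    cases x with exhaustive x
    ... | here eq                 = inj₁ eq
    ... | there (here eq)         = inj₂ (inj₁ eq)
    ... | there (there (here eq)) = inj₂ (inj₂ eq)
  ... | no U  | _     | no W  = two-pure cases u≢v (≢-sym v≢w) u≢w U W
    where
    cases : ∀ x → ℓ x ≡ ℓ v ⊎ ℓ x ≡ ℓ u ⊎ ℓ x ≡ ℓ w
    cases x with exhaustive x
    ... | here eq                 = inj₂ (inj₁ eq)
    ... | there (here eq)         = inj₁ eq
    ... | there (there (here eq)) = inj₂ (inj₂ eq)
  ... | no U  | no V  | _     = two-pure cases u≢w v≢w u≢v U V
    where
    cases : ∀ x → ℓ x ≡ ℓ w ⊎ ℓ x ≡ ℓ u ⊎ ℓ x ≡ ℓ v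
    cases x with exhaustive x
    ... | here eq                 = inj₂ (inj₁ eq)
    ... | there (here eq)         = inj₂ (inj₂ eq)
    ... | there (there (here eq)) = inj₁ eq

-- Colourings in which no vertex sees three colours.

module NoClaw {n s : ℕ} (c : EdgeColoring (K n) 4) (7≤s : 7 ≤ s) (large : suc (4 * s) ≤ n)
  (no-claw : ∀ {y i j k} → ∃ (Edge c i y) → ∃ (Edge c j y) → ∃ (Edge c k y) → ¬ Unique (i ∷ j ∷ k ∷ [])) where

  private
    χ = color c
    χ-sym = EdgeColoring.sym c

  Sees : Fin n → Fin 4 → Set
  Sees y i = ∃ (Edge c i y)

  sees₁ : ∀ {x y i} → Edge c i x y → Sees x i
  sees₁ xy = _ , xy

  sees₂ : ∀ {x y i} → Edge c i x y → Sees y i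
  sees₂ xy = _ , edge-sym c xy

  two-colours : ∀ {y v i j} → i ≢ j → Sees y i → Sees y j → y ≢ v → Edge c i y v ⊎ Edge c j y v
  two-colours {y} {v} {i} {j} i≢j yi yj y≢v with χ y v ≟ i | χ y v ≟ j
  ... | yes eq | _      = inj₁ (y≢v , eq)
  ... | no _   | yes eq = inj₂ (y≢v , eq)
  ... | no ≢i  | no ≢j  = contradiction ((≢i ∷ ≢j ∷ []) ∷ (i≢j ∷ []) ∷ [] ∷ [])
                            (no-claw (sees₁ (y≢v , refl)) yi yj)

  -- Apart from `d`, each vertex sees at most one colour. In this form the label of a vertex does
  -- not depend on the edge from which it is read off.
  Dominant : Fin 4 → Set
  Dominant d = ∀ {v x z} → v ≢ x → v ≢ z → χ v x ≢ d → χ v z ≢ d → χ v x ≡ χ v z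

  -- If `v` had edges of two different colours other than `i`, it could not see `i`. Its edges to
  -- `y`, `a` and `e` would then have colours `j`, `k` and `l`, three colours at `v`.
  common-colour : ∀ {i j k l y a e} → Unique (i ∷ j ∷ k ∷ l ∷ []) → Sees y i → Sees y j →
    Sees a i → Sees a k → Sees e i → Sees e l → Dominant i
  common-colour {i} {j} {k} {l} ((i≢j ∷ i≢k ∷ i≢l ∷ []) ∷ jkl!@((j≢k ∷ j≢l ∷ []) ∷ (k≢l ∷ []) ∷ [] ∷ []))
    yi yj ai ak ei el {v} {x} {z} v≢x v≢z ≢i ≢i′ with χ v x ≟ χ v z
  ... | yes eq = eq
  ... | no p≢q = contradiction jkl! (no-claw (second i≢j yi yj) (second i≢k ai ak) (second i≢l ei el))
    where
    ¬vi : ¬ Sees v i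
    ¬vi vi = no-claw vi (sees₁ (v≢x , refl)) (sees₁ (v≢z , refl)) ((≢-sym ≢i ∷ ≢-sym ≢i′ ∷ []) ∷ (p≢q ∷ []) ∷ [] ∷ [])

    second : ∀ {w m} → i ≢ m → Sees w i → Sees w m → Sees v m
    second i≢m wi wm with two-colours i≢m wi wm (λ { refl → ¬vi wi })
    ... | inj₁ wv = contradiction (sees₂ wv) ¬vi
    ... | inj₂ wv = sees₂ wv

  -- An end `e` of an edge of colour `l` sees `i` as well: otherwise its edges to `y` and `a` would
  -- have colours `j` and `k`, and `e` would see `j`, `k` and `l`.
  third-vertex : ∀ {i j k l y a} → Unique (i ∷ j ∷ k ∷ l ∷ []) → Sees y i → Sees y j →
    Sees a i → Sees a k → Dominant i
  third-vertex {i} {j} {k} {l} {y} {a} ijkl!@((i≢j ∷ i≢k ∷ i≢l ∷ []) ∷ (j≢k ∷ j≢l ∷ []) ∷ (k≢l ∷ []) ∷ [] ∷ []) yi yj ai ak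
    with e , f , e≢f , ef ← EdgeColoring.exact c l = common-colour ijkl! yi yj ai ak ei el
    where
    el : Sees e l
    el = sees₁ (e≢f , ef)

    ei : Sees e i
    ei with two-colours i≢j yi yj (λ { refl → no-claw yi yj el ((i≢j ∷ i≢l ∷ []) ∷ (j≢l ∷ []) ∷ [] ∷ []) })
          | two-colours i≢k ai ak (λ { refl → no-claw ai ak el ((i≢k ∷ i≢l ∷ []) ∷ (k≢l ∷ []) ∷ [] ∷ []) })
    ... | inj₁ ye | _       = sees₂ ye
    ... | inj₂ _  | inj₁ ae = sees₂ ae
    ... | inj₂ ye | inj₂ ae = contradiction ((j≢k ∷ j≢l ∷ []) ∷ (k≢l ∷ []) ∷ [] ∷ []) (no-claw (sees₂ ye) (sees₂ ae) el)

  -- Take edges of colours 0 and 1. If their first ends differ, the edge between these ends adds a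
  -- second colour at one of them.
  two-coloured-vertex : ∃ λ y → ∃₂ λ i j → i ≢ j × Sees y i × Sees y j
  two-coloured-vertex with EdgeColoring.exact c zero | EdgeColoring.exact c (suc zero)
  ... | u , u′ , u≢u′ , uu′ | v , v′ , v≢v′ , vv′ with u ≟ v
  ... | yes refl = u , zero , suc zero , (λ ()) , (_ , u≢u′ , uu′) , (_ , v≢v′ , vv′)
  ... | no u≢v with χ u v ≟ zero
  ... | yes uv = v , zero , suc zero , (λ ()) , sees₂ (u≢v , uv) , (_ , v≢v′ , vv′)
  ... | no ≢0  = u , χ u v , zero , ≢0 , sees₁ (u≢v , refl) , (_ , u≢u′ , uu′)

  -- Let `y` see `i` and `j`, and let `a` be an end of an edge of a third colour. The edge from `y`
  -- to `a` has colour `i` or `j`, and this colour is the dominant one.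
  dominant-colour : ∃ Dominant
  dominant-colour with y , i , j , i≢j , yi , yj ← two-coloured-vertex
    with k , k∉ ← fresh (i ∷ j ∷ []) (s≤s (s≤s (s≤s z≤n)))
    with l , l∉ ← fresh (k ∷ i ∷ j ∷ []) (s≤s (s≤s (s≤s (s≤s z≤n))))
    with ∉⇒All≢ k∉ | ∉⇒All≢ l∉
  ... | k≢i ∷ k≢j ∷ [] | l≢k ∷ l≢i ∷ l≢j ∷ []
    with a , b , a≢b , ab ← EdgeColoring.exact c k
    with two-colours i≢j yi yj (λ { refl → no-claw yi yj (sees₁ (a≢b , ab))
                                    ((i≢j ∷ ≢-sym k≢i ∷ []) ∷ (≢-sym k≢j ∷ []) ∷ [] ∷ []) })
  ... | inj₁ ya = i , third-vertex ((i≢j ∷ ≢-sym k≢i ∷ ≢-sym l≢i ∷ []) ∷ (≢-sym k≢j ∷ ≢-sym l≢j ∷ []) ∷ (≢-sym l≢k ∷ []) ∷ [] ∷ [])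
                        yi yj (sees₂ ya) (sees₁ (a≢b , ab))
  ... | inj₂ ya = j , third-vertex ((≢-sym i≢j ∷ ≢-sym k≢j ∷ ≢-sym l≢j ∷ []) ∷ (≢-sym k≢i ∷ ≢-sym l≢i ∷ []) ∷ (≢-sym l≢k ∷ []) ∷ [] ∷ [])
                        yj yi (sees₂ ya) (sees₁ (a≢b , ab))

  module _ {d : Fin 4} (dominant : Dominant d) (i : Fin 4) where

    off? : ∀ v → Dec (∃ λ x → v ≢ x × χ v x ≢ d)
    off? v = any? λ x → ¬? (v ≟ x) ×-dec ¬? (χ v x ≟ d)

    -- A vertex all of whose edges have colour `d` takes the default `i`; this is harmless, since
    -- labels are compared only with edges of other colours.
    label : Fin n → Fin 4
    label v with off? v
    ... | yes (x , _) = χ v x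
    ... | no _        = i

    label-≢ : i ≢ d → ∀ v → label v ≢ d
    label-≢ i≢d v with off? v
    ... | yes (x , _ , ≢d) = ≢d
    ... | no _             = i≢d

    label-off : ∀ {u v} → u ≢ v → χ u v ≢ d → χ u v ≡ label u
    label-off {u} u≢v ≢d with off? u
    ... | yes (x , u≢x , ≢d′) = dominant u≢v u≢x ≢d ≢d′
    ... | no none             = contradiction (_ , u≢v , ≢d) none

    label-colours : ∀ {u v} → u ≢ v → χ u v ≡ d ⊎ (χ u v ≡ label u × χ u v ≡ label v)
    label-colours {u} {v} u≢v with χ u v ≟ d
    ... | yes eq = inj₁ eq
    ... | no ≢d  = inj₂ (label-off u≢v ≢d , trans (χ-sym u v) (label-off (≢-sym u≢v) (≢d ∘ trans (χ-sym u v))))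

    label-onto : ∀ j → j ≢ d → ∃ λ v → label v ≡ j
    label-onto j j≢d with u , v , u≢v , refl ← EdgeColoring.exact c j = u , sym (label-off u≢v j≢d)

  no-claw⇒pineapple : ∃ (Monochromatic {G = PA (suc s) 5} c)
  no-claw⇒pineapple with d , dominant ← dominant-colour
    with i , i∉ ← fresh (d ∷ []) (s≤s (s≤s z≤n))
    with j , j∉ ← fresh (i ∷ d ∷ []) (s≤s (s≤s (s≤s z≤n)))
    with k , k∉ ← fresh (j ∷ i ∷ d ∷ []) (s≤s (s≤s (s≤s (s≤s z≤n))))
    -- By exactness each of the three colours other than `d` lies on an edge, so none of the three
    -- classes is empty.
    with u , eqᵤ ← label-onto dominant i i (λ { refl → i∉ (here refl) })
    with v , eqᵥ ← label-onto dominant i j (λ { refl → j∉ (there (here refl)) })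
    with w , eqw ← label-onto dominant i k (λ { refl → k∉ (there (there (here refl))) })
    = Dominated.dominated c 7≤s large d ℓ (label-colours dominant i) {w} {v} {u} (rename kji!) λ x → rename′ (outside x)
    where
    ℓ = label dominant i

    kji! : Unique (k ∷ j ∷ i ∷ [])
    kji! = ∷-unique (λ k∈ → k∉ (∈-++⁺ˡ k∈)) (∷-unique (λ j∈ → j∉ (∈-++⁺ˡ j∈)) ([] ∷ []))

    rename : Unique (k ∷ j ∷ i ∷ []) → Unique (ℓ w ∷ ℓ v ∷ ℓ u ∷ [])
    rename rewrite eqᵤ | eqᵥ | eqw = λ z → z

    rename′ : ∀ {x} → x ∈ k ∷ j ∷ i ∷ [] → x ∈ ℓ w ∷ ℓ v ∷ ℓ u ∷ []
    rename′ rewrite eqᵤ | eqᵥ | eqw = λ z → z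

    outside : ∀ x → ℓ x ∈ k ∷ j ∷ i ∷ []
    outside x with ∈-++⁻ (k ∷ j ∷ i ∷ []) (complete (∷-unique k∉ (∷-unique j∉ (∷-unique i∉ ([] ∷ [])))) ≤-refl (ℓ x))
    ... | inj₁ x∈          = x∈
    ... | inj₂ (here eq)   = contradiction eq (label-≢ dominant i (λ { refl → i∉ (here refl) }) x)

-- Search for forced colours

PartialColouring : ℕ → Set
PartialColouring m = Vec (Vec (Maybe (Fin 4)) m) m

module _ {m : ℕ} where

  infix 9 _⟨_,_⟩
  _⟨_,_⟩ : PartialColouring m → Fin m → Fin m → Maybe (Fin 4)
  Γ ⟨ i , j ⟩ = Vec.lookup (Vec.lookup Γ i) j

  put : Fin m → Fin m → Fin 4 → PartialColouring m → PartialColouring m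
  put i j k Γ = Vec.updateAt Γ i (λ row → Vec.updateAt row j (λ _ → just k))

  assign : Fin m × Fin m → Fin 4 → PartialColouring m → PartialColouring m
  assign (i , j) k Γ = put i j k (put j i k Γ)

  blank : PartialColouring m
  blank = Vec.replicate m (Vec.replicate m nothing)

  -- The new vertex gets number 0, to match a vertex put in front of the list that interprets the
  -- numbers.
  widen : PartialColouring m → PartialColouring (suc m)
  widen Γ = Vec.replicate (suc m) nothing ∷ Vec.map (nothing ∷_) Γ

  isRainbow : PartialColouring m → List (Fin m) → Bool
  isRainbow Γ (u ∷ v ∷ w ∷ x ∷ y ∷ []) with Γ ⟨ u , v ⟩ | Γ ⟨ v , w ⟩ | Γ ⟨ w , x ⟩ | Γ ⟨ x , y ⟩
  ... | just i | just j | just k | just l =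
    isYes (unique? _≟_ (i ∷ j ∷ k ∷ l ∷ [])) ∧ isYes (unique? _≟_ (u ∷ v ∷ w ∷ x ∷ y ∷ []))
  ... | _ | _ | _ | _ = false
  isRainbow Γ _ = false

  -- A path, listed from its growing end, with the colours of its edges.
  Trail : Set
  Trail = List (Fin 4) × List (Fin m)

  extensions : PartialColouring m → ℕ → Trail → List Trail
  extensions Γ zero    τ               = τ ∷ []
  extensions Γ (suc s) (_  , [])       = []
  extensions Γ (suc s) (ks , v ∷ path) = concatMap extend (allFin m)
    where
    extend : Fin m → List Trail
    extend w with Γ ⟨ v , w ⟩
    ... | nothing = []
    ... | just k  = if any (λ k′ → does (k ≟ k′)) ks ∨ any (λ v′ → does (w ≟ v′)) path
                    then [] else extensions Γ s (k ∷ ks , w ∷ v ∷ path)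

  -- The edge (i , j) is extended by r edges at i and by s edges at j.  Nothing is
  -- proved about this enumeration, since isRainbow rechecks every candidate.
  rainbowsThrough : PartialColouring m → Fin m × Fin m → Fin 4 → List Trail
  rainbowsThrough Γ (i , j) k = concatMap
    -- Reversal makes the other end of the path the growing one.
    (λ (r , s) → concatMap (λ (ks , path) → extensions Γ s (ks , reverse path))
                           (extensions Γ r (k ∷ [] , i ∷ j ∷ [])))
    ((0 , 3) ∷ (1 , 2) ∷ (2 , 1) ∷ (3 , 0) ∷ [])

  -- Trying only paths through the edge just coloured keeps the search short. An overlooked path
  -- could cost a certificate, never soundness.
  refuted : PartialColouring m → Fin m × Fin m → Fin 4 → Bool
  refuted Γ e k = any (isRainbow Γ ∘ proj₂) (rainbowsThrough Γ e k)

  survives : List (Fin m × Fin m) → (PartialColouring m → Bool) → PartialColouring m → Fin m × Fin m → Fin 4 → Bool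

  -- Branches over the colours of the given edges, discarding every branch with
  -- a rainbow P₅; Q must hold at each surviving leaf.
  everywhere : List (Fin m × Fin m) → (PartialColouring m → Bool) → PartialColouring m → Bool
  everywhere []             Q Γ = Q Γ
  everywhere ((i , j) ∷ es) Q Γ with Γ ⟨ i , j ⟩
  ... | just _  = everywhere es Q Γ
  ... | nothing = all (λ k → survives es Q (assign (i , j) k Γ) (i , j) k) (allFin 4)

  survives es Q Δ e k = refuted Δ e k ∨ everywhere es Q Δ

pairs : ∀ m → List (Fin m × Fin m)
pairs zero    = []
pairs (suc m) = map (λ i → zero , suc i) (allFin m) ++ map (λ (i , j) → suc i , suc j) (pairs m)

-- Two further vertices, numbered 0 and 1, are joined by an edge of colour k.
joined : ∀ {m} → PartialColouring m → Fin 4 → PartialColouring (2 + m)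
joined Γ k = assign (zero , suc zero) k (widen (widen Γ))

-- With the constantly false predicate, success means that every completion has a rainbow P₅, so the
-- added edge cannot have colour `k`.
forcesAgainst : ∀ {m} → PartialColouring m → Fin 4 → Fin 4 → Bool
forcesAgainst {m} Γ d k = does (k ≟ d) ∨ everywhere (pairs (2 + m)) (λ _ → false) (joined Γ k)

forces : ∀ {m} → PartialColouring m → Fin 4 → Bool
forces {m} Γ d = all (forcesAgainst Γ d) (allFin 4)

module _ {m : ℕ} (e₀ e₁ e₂ e₃ : Fin m × Fin m) where

  kernel : PartialColouring m
  kernel = assign e₀ 0F (assign e₁ 1F (assign e₂ 2F (assign e₃ 3F blank)))

  -- Opaque, so that each search is evaluated only once, in its certificate.
  opaque
    isForcing : Bool
    isForcing = everywhere (pairs m) (λ Γ → any (forces Γ) (allFin 4)) kernel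

-- σ renames the colours so that the four edges of the kernel have colours 0 to 3.
module Soundness {n : ℕ} (χ : Fin n → Fin n → Fin 4) (χ-sym : ∀ u v → χ u v ≡ χ v u)
  (no-rainbow : ∀ {u v w x y} → Unique (u ∷ v ∷ w ∷ x ∷ y ∷ []) →
                ¬ Unique (χ u v ∷ χ v w ∷ χ w x ∷ χ x y ∷ []))
  (σ : Fin 4 → Fin 4) (σ-injective : ∀ {k l} → σ k ≡ σ l → k ≡ l) (σ-surjective : ∀ l → ∃ λ k → l ≡ σ k) where

  -- Soundness of the search: models of partial colourings.

  module _ {m : ℕ} (f : Fin m → Fin n) where

    record Models (Γ : PartialColouring m) : Set where
      constructor models
      field colour-at : ∀ i j {k} → Γ ⟨ i , j ⟩ ≡ just k → χ (f i) (f j) ≡ σ k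

    put-sound : ∀ {i j k Γ} → χ (f i) (f j) ≡ σ k → Models Γ → Models (put i j k Γ)
    put-sound {i} {j} {k} {Γ} ij (models Γ-ok) = models λ u v uv → at u v uv
      where
      at : ∀ u v {l} → put i j k Γ ⟨ u , v ⟩ ≡ just l → χ (f u) (f v) ≡ σ l
      at u v uv with u ≟ i
      ... | no u≢i = Γ-ok u v (trans (cong (λ row → Vec.lookup row v) (sym (lookup∘updateAt′ u i u≢i Γ))) uv)
      ... | yes refl with v ≟ j
      ...   | no v≢j = Γ-ok u v (trans (sym (lookup∘updateAt′ v j v≢j (Vec.lookup Γ u)))
                       (trans (cong (λ row → Vec.lookup row v) (sym (lookup∘updateAt u Γ))) uv))
      ...   | yes refl = trans ij (cong σ (just-injective (trans (sym (lookup∘updateAt v (Vec.lookup Γ u)))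
                       (trans (cong (λ row → Vec.lookup row v) (sym (lookup∘updateAt u Γ))) uv))))

    assign-sound : ∀ {i j k Γ} → χ (f i) (f j) ≡ σ k → Models Γ → Models (assign (i , j) k Γ)
    assign-sound {i} {j} ij Γ-ok = put-sound ij (put-sound (trans (χ-sym (f j) (f i)) ij) Γ-ok)

    blank-sound : Models blank
    blank-sound = models λ i j eq → contradiction (trans (sym (lookup-replicate j nothing))
      (trans (cong (λ row → Vec.lookup row j) (sym (lookup-replicate i _))) eq)) λ ()

    module _ (f-injective : ∀ {i j} → f i ≡ f j → i ≡ j) where

      isRainbow-sound : ∀ {Γ} p → Models Γ → ¬ T (isRainbow Γ p)
      isRainbow-sound {Γ} (u ∷ v ∷ w ∷ x ∷ y ∷ []) (models Γ-ok) rainbow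
        with Γ ⟨ u , v ⟩ in uv | Γ ⟨ v , w ⟩ in vw | Γ ⟨ w , x ⟩ in wx | Γ ⟨ x , y ⟩ in xy
      ... | just i | just j | just k | just l
        with colours! , path! ← Equivalence.to (T-∧ {isYes (unique? _≟_ (i ∷ j ∷ k ∷ l ∷ []))}) rainbow =
        no-rainbow (Unique.map⁺ f-injective (toWitness {a? = unique? _≟_ (u ∷ v ∷ w ∷ x ∷ y ∷ [])} path!)) unique
        where
        unique : Unique (χ (f u) (f v) ∷ χ (f v) (f w) ∷ χ (f w) (f x) ∷ χ (f x) (f y) ∷ [])
        unique rewrite Γ-ok u v uv | Γ-ok v w vw | Γ-ok w x wx | Γ-ok x y xy =
          Unique.map⁺ σ-injective (toWitness {a? = unique? _≟_ (i ∷ j ∷ k ∷ l ∷ [])} colours!)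

      -- The actual colours select one branch at each unassigned edge. That branch cannot be
      -- refuted, so it leads to a leaf that describes the colouring and satisfies `Q`.
      everywhere-sound : ∀ es {Q Γ} → Models Γ → T (everywhere es Q Γ) → ∃ λ Δ → Models Δ × T (Q Δ)
      everywhere-sound [] Γ-ok holds = _ , Γ-ok , holds
      everywhere-sound ((i , j) ∷ es) {Q} {Γ} Γ-ok holds with Γ ⟨ i , j ⟩
      ... | just _ = everywhere-sound es Γ-ok holds
      ... | nothing with k , ij ← σ-surjective (χ (f i) (f j))
        with Equivalence.to (T-∨ {refuted (assign (i , j) k Γ) (i , j) k})
               (All.lookup (all⁺ (λ k → survives es Q (assign (i , j) k Γ) (i , j) k) (allFin 4) holds) (∈-allFin k))
      ...   | inj₂ rest = everywhere-sound es (assign-sound ij Γ-ok) rest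
      ...   | inj₁ bad
        with τ , rainbow ← Any.satisfied (any⁻ (isRainbow (assign (i , j) k Γ) ∘ proj₂)
                             (rainbowsThrough (assign (i , j) k Γ) (i , j) k) bad) =
        contradiction rainbow (isRainbow-sound (proj₂ τ) (assign-sound ij Γ-ok))

  widen-sound : ∀ {xs x Γ} → Models (lookup xs) Γ → Models (lookup (x ∷ xs)) (widen Γ)
  widen-sound {xs} {x} {Γ} (models Γ-ok) = models at
    where
    at : ∀ i j {k} → widen Γ ⟨ i , j ⟩ ≡ just k → χ (lookup (x ∷ xs) i) (lookup (x ∷ xs) j) ≡ σ k
    at zero j eq = contradiction (trans (sym (lookup-replicate j nothing)) eq) λ ()
    at (suc i) zero eq =
      contradiction (trans (sym (cong (λ row → Vec.lookup row zero) (lookup-map i (nothing ∷_) Γ))) eq) λ ()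
    at (suc i) (suc j) eq =
      Γ-ok i j (trans (sym (cong (λ row → Vec.lookup row (suc j)) (lookup-map i (nothing ∷_) Γ))) eq)

  -- If the edge from `u` to `v` had another colour, the extended colouring would be a model and
  -- would reach a leaf where the constantly false predicate holds.
  forces-sound : ∀ {xs Γ d} → Unique xs → Models (lookup xs) Γ → T (forces Γ d) →
    ∀ {u v} → u ≢ v → u ∉ xs → v ∉ xs → χ u v ≡ σ d
  forces-sound {xs} {Γ} {d} xs! Γ-ok forced {u} {v} u≢v u∉ v∉ with k , uv ← σ-surjective (χ u v)
    with k ≟ d | All.lookup (all⁺ (forcesAgainst Γ d) (allFin 4) forced) (∈-allFin k)
  ... | yes refl | _      = uv
  ... | no _     | refute with () ← proj₂ (proj₂ (everywhere-sound (lookup (u ∷ v ∷ xs))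
          (lookup-injective ((u≢v ∷ ∉⇒All≢ u∉) ∷ ∉⇒All≢ v∉ ∷ xs!))
          (pairs (2 + length xs)) {Q = λ _ → false} {Γ = joined Γ k}
          (assign-sound (lookup (u ∷ v ∷ xs)) {i = zero} {j = suc zero} uv (widen-sound (widen-sound Γ-ok))) refute))

module _ {n : ℕ} (χ : Fin n → Fin n → Fin 4) (χ-sym : ∀ u v → χ u v ≡ χ v u)
  (no-rainbow : ∀ {u v w x y} → Unique (u ∷ v ∷ w ∷ x ∷ y ∷ []) →
                ¬ Unique (χ u v ∷ χ v w ∷ χ w x ∷ χ x y ∷ [])) where

  opaque
    unfolding isForcing

    isForcing-sound : ∀ {xs} → Unique xs → (e₀ e₁ e₂ e₃ : Fin (length xs) × Fin (length xs)) →
      let χ′ = λ (i , j) → χ (lookup xs i) (lookup xs j) in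
      Unique (χ′ e₀ ∷ χ′ e₁ ∷ χ′ e₂ ∷ χ′ e₃ ∷ []) → isForcing e₀ e₁ e₂ e₃ ≡ true →
      ∃ λ d → ∀ {u v} → u ≢ v → u ∉ xs → v ∉ xs → χ u v ≡ d
    isForcing-sound {xs} xs! e₀ e₁ e₂ e₃ colours! forcing =
      let Γ , Γ-ok , forced = everywhere-sound f (lookup-injective xs!) (pairs (length xs))
            {Q = λ Γ → any (forces Γ) (allFin 4)} {Γ = kernel e₀ e₁ e₂ e₃}
            (assign-sound f refl (assign-sound f refl (assign-sound f refl (assign-sound f refl (blank-sound f)))))
            (Equivalence.from T-≡ forcing)
          d , d-forced = Any.satisfied (any⁻ (forces Γ) (allFin 4) forced)
      in _ , forces-sound {d = d} xs! Γ-ok d-forced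
      where
      f : Fin (length xs) → Fin n
      f = lookup xs
      -- Four distinct colours exhaust `Fin 4`, so listing them in order is the required renaming.
      open Soundness χ χ-sym no-rainbow _ (lookup-injective colours!)
        (λ l → Any.index (complete colours! ≤-refl l) , lookup-index (complete colours! ≤-refl l))

-- Certificates of the finite search.

opaque
  unfolding isForcing

  -- Each kernel is the claw at vertex 0 with leaves 1 to 3 and an edge of the fourth colour. Here
  -- that edge starts at the centre; in the next three it meets one leaf, two leaves, or no vertex
  -- of the claw.
  star-forcing : isForcing {5} (0F , 1F) (0F , 2F) (0F , 3F) (0F , 4F) ≡ true
  star-forcing = refl

  spider-forcing : isForcing {5} (0F , 1F) (0F , 2F) (0F , 3F) (1F , 4F) ≡ true
  spider-forcing = refl

  -- The four edges span only vertices 0 to 3; vertex 4 is the additional one.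
  paw-forcing : isForcing {5} (0F , 1F) (0F , 2F) (0F , 3F) (1F , 2F) ≡ true
  paw-forcing = refl

  claw+edge-forcing : isForcing {6} (0F , 1F) (0F , 2F) (0F , 3F) (4F , 5F) ≡ true
  claw+edge-forcing = refl

-- Colourings in which some vertex sees three colours.

module WithClaw {n s : ℕ} (c : EdgeColoring (K n) 4) (7≤s : 7 ≤ s) (large : suc (4 * s) ≤ n)
  (no-rainbow : ∀ {u v w x y} → Unique (u ∷ v ∷ w ∷ x ∷ y ∷ []) →
                ¬ Unique (color c u v ∷ color c v w ∷ color c w x ∷ color c x y ∷ [])) where

  private
    χ = color c
    χ-sym = EdgeColoring.sym c
    Goal = ∃ (Monochromatic {G = PA (suc s) 5} c)

  6+t≤n : 6 + suc s ≤ n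
  6+t≤n = ≤-trans (≤-trans (≤-reflexive (+-comm 6 (suc s)))
    (s≤s (+-monoʳ-≤ s (≤-trans (≤-trans (m≤m+n 6 1) 7≤s) (m≤m+n s _))))) large

  forced⇒pineapple : ∀ xs → length xs ≤ 6 → (∃ λ d → ∀ {u v} → u ≢ v → u ∉ xs → v ∉ xs → χ u v ≡ d) → Goal
  forced⇒pineapple xs xs≤6 (d , forced) = large-clique⇒pineapple c clique (s≤s (≤-trans (m≤m+n 4 3) 7≤s))
    (+-cancelˡ-≤ 6 _ _ (≤-trans 6+t≤n (≤-trans (≤-reflexive (sym length-allFin))
      (≤-trans (length-split allFin! split) (+-monoˡ-≤ _ xs≤6)))))
    where
    outside? = λ u → ¬? (u ∈? xs)
    rest = filter outside? (allFin n)

    ∉xs : ∀ {u} → u ∈ rest → u ∉ xs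
    ∉xs u∈ = proj₂ (∈-filter⁻ outside? {xs = allFin n} u∈)

    clique : Clique c d rest
    clique = clique-from c (Unique.filter⁺ outside? allFin!) λ u∈ v∈ u≢v → forced u≢v (∉xs u∈) (∉xs v∈)

    split : ∀ {u} → u ∈ allFin n → u ∈ xs ⊎ u ∈ rest
    split {u} u∈ with u ∈? xs
    ... | yes u∈xs = inj₁ u∈xs
    ... | no u∉xs  = inj₂ (∈-filter⁺ outside? u∈ u∉xs)

  forcing⇒pineapple : ∀ {xs} → Unique xs → length xs ≤ 6 → ∀ {e₀ e₁ e₂ e₃ : Fin (length xs) × Fin (length xs)} →
    let χ′ = λ (i , j) → χ (lookup xs i) (lookup xs j) in
    isForcing e₀ e₁ e₂ e₃ ≡ true → Unique (χ′ e₀ ∷ χ′ e₁ ∷ χ′ e₂ ∷ χ′ e₃ ∷ []) → Goal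
  forcing⇒pineapple {xs} xs! xs≤6 certificate colours! = forced⇒pineapple xs xs≤6
    (isForcing-sound χ χ-sym no-rainbow xs! _ _ _ _ colours! certificate)

  -- The parameter `l` is the fourth colour, kept apart from any edge so that the leaves can be
  -- permuted freely. That the leaves are distinct follows from their colours in `claw!`.
  record Claw (y x z w : Fin n) (l : Fin 4) : Set where
    constructor claw
    field
      y≢x : y ≢ x
      y≢z : y ≢ z
      y≢w : y ≢ w
      colours! : Unique (χ y x ∷ χ y z ∷ χ y w ∷ l ∷ [])

  open Claw

  swap₁₂ : ∀ {y x z w l} → Claw y x z w l → Claw y z x w l
  swap₁₂ (claw p q r ((a≢b ∷ a≢c ∷ a≢d ∷ []) ∷ b- ∷ cd)) =
    claw q p r ((≢-sym a≢b ∷ b-) ∷ (a≢c ∷ a≢d ∷ []) ∷ cd)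

  swap₂₃ : ∀ {y x z w l} → Claw y x z w l → Claw y x w z l
  swap₂₃ (claw p q r ((a≢b ∷ a≢c ∷ a≢d ∷ []) ∷ (b≢c ∷ b≢d ∷ []) ∷ (c≢d ∷ []) ∷ [] ∷ [])) =
    claw p r q ((a≢c ∷ a≢b ∷ a≢d ∷ []) ∷ (≢-sym b≢c ∷ c≢d ∷ []) ∷ (b≢d ∷ []) ∷ [] ∷ [])

  claw! : ∀ {y x z w l} → Claw y x z w l → Unique (y ∷ x ∷ z ∷ w ∷ [])
  claw! (claw p q r ((a≢b ∷ a≢c ∷ a≢d ∷ []) ∷ (b≢c ∷ b≢d ∷ []) ∷ _)) =
    (p ∷ q ∷ r ∷ []) ∷ ((λ { refl → a≢b refl }) ∷ (λ { refl → a≢c refl }) ∷ []) ∷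
    ((λ { refl → b≢c refl }) ∷ []) ∷ [] ∷ []

  snoc! : ∀ {xs : List (Fin n)} {u} → Unique xs → u ∉ xs → Unique (xs ++ u ∷ [])
  snoc! xs! u∉ = Unique.++⁺ xs! ([] ∷ []) λ { (u∈ , here refl) → u∉ u∈ }

  star : ∀ {y x z w v} → y ≢ v → Claw y x z w (χ y v) → Goal
  star {y} {x} {z} {w} {v} y≢v cl@(claw p q r ((_ ∷ _ ∷ a≢d ∷ []) ∷ (_ ∷ b≢d ∷ []) ∷ (c≢d ∷ []) ∷ [] ∷ [])) =
    forcing⇒pineapple (snoc! (claw! cl) v∉) (m≤m+n 5 1) star-forcing (colours! cl)
    where
    v∉ : v ∉ y ∷ x ∷ z ∷ w ∷ []
    v∉ (here refl)                         = y≢v refl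
    v∉ (there (here refl))                 = a≢d refl
    v∉ (there (there (here refl)))         = b≢d refl
    v∉ (there (there (there (here refl)))) = c≢d refl

  spider : ∀ {y x z w u} → u ∉ y ∷ x ∷ z ∷ w ∷ [] → Claw y x z w (χ x u) → Goal
  spider u∉ cl = forcing⇒pineapple (snoc! (claw! cl) u∉) (m≤m+n 5 1) spider-forcing (colours! cl)

  spider₂ : ∀ {y x z w u} → u ∉ y ∷ x ∷ z ∷ w ∷ [] → Claw y x z w (χ z u) → Goal
  spider₂ u∉ cl = spider (u∉ ∘ λ
    { (here eq)                 → here eq
    ; (there (here eq))         → there (there (here eq))
    ; (there (there (here eq))) → there (here eq)
    ; (there (there (there p))) → there (there (there p)) }) (swap₁₂ cl)

  spider₃ : ∀ {y x z w u} → u ∉ y ∷ x ∷ z ∷ w ∷ [] → Claw y x z w (χ w u) → Goal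
  spider₃ u∉ cl = spider₂ (u∉ ∘ λ
    { (here eq)                         → here eq
    ; (there (here eq))                 → there (here eq)
    ; (there (there (here eq)))         → there (there (there (here eq)))
    ; (there (there (there (here eq)))) → there (there (here eq)) }) (swap₂₃ cl)

  paw : ∀ {y x z w} → Claw y x z w (χ x z) → Goal
  paw {y} {x} {z} {w} cl
    -- A fifth vertex is supplied for vertex 4 of the kernel.
    with fresh (y ∷ x ∷ z ∷ w ∷ []) (≤-trans (m≤m+n 5 (suc (suc s))) (≤-trans (≤-reflexive (+-suc 5 (suc s))) 6+t≤n))
  ... | r , r∉ = forcing⇒pineapple (snoc! (claw! cl) r∉) (m≤m+n 5 1) paw-forcing (colours! cl)

  claw+edge : ∀ {y x z w u v} → u ∉ y ∷ x ∷ z ∷ w ∷ [] → v ∉ y ∷ x ∷ z ∷ w ∷ [] → u ≢ v → Claw y x z w (χ u v) → Goal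
  claw+edge u∉ v∉ u≢v cl = forcing⇒pineapple
    (Unique.++⁺ (claw! cl) ((u≢v ∷ []) ∷ [] ∷ [])
      λ { (u∈ , here refl) → u∉ u∈ ; (v∈ , there (here refl)) → v∉ v∈ })
    ≤-refl claw+edge-forcing (colours! cl)

  data Position (y x z w : Fin n) : Fin n → Set where
    centre  : Position y x z w y
    leaf₁   : Position y x z w x
    leaf₂   : Position y x z w z
    leaf₃   : Position y x z w w
    outside : ∀ {u} → u ∉ y ∷ x ∷ z ∷ w ∷ [] → Position y x z w u

  position : ∀ y x z w u → Position y x z w u
  position y x z w u with u ∈? y ∷ x ∷ z ∷ w ∷ []
  ... | yes (here refl)                         = centre
  ... | yes (there (here refl))                 = leaf₁
  ... | yes (there (there (here refl)))         = leaf₂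
  ... | yes (there (there (there (here refl)))) = leaf₃
  ... | no u∉                                   = outside u∉

  flip : ∀ {y x z w u v} → Claw y x z w (χ u v) → Claw y x z w (χ v u)
  flip {y} {x} {z} {w} {u} {v} = subst (Claw y x z w) (χ-sym u v)

  -- Permuting the leaves and reversing the edge reduces all positions of its ends to the four
  -- certified kernels.
  fourth-colour : ∀ {y x z w u v} → u ≢ v → Claw y x z w (χ u v) → Position y x z w u → Position y x z w v → Goal
  fourth-colour u≢v cl centre       _            = star u≢v cl
  fourth-colour u≢v cl _            centre       = star (≢-sym u≢v) (flip cl)
  fourth-colour u≢v cl leaf₁        leaf₁        = contradiction refl u≢v
  fourth-colour u≢v cl leaf₂        leaf₂        = contradiction refl u≢v
  fourth-colour u≢v cl leaf₃        leaf₃        = contradiction refl u≢v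
  fourth-colour u≢v cl leaf₁        leaf₂        = paw cl
  fourth-colour u≢v cl leaf₂        leaf₁        = paw (swap₁₂ cl)
  fourth-colour u≢v cl leaf₁        leaf₃        = paw (swap₂₃ cl)
  fourth-colour u≢v cl leaf₃        leaf₁        = paw (swap₂₃ (flip cl))
  fourth-colour u≢v cl leaf₂        leaf₃        = paw (swap₂₃ (swap₁₂ cl))
  fourth-colour u≢v cl leaf₃        leaf₂        = paw (swap₂₃ (swap₁₂ (flip cl)))
  fourth-colour u≢v cl leaf₁        (outside v∉) = spider v∉ cl
  fourth-colour u≢v cl (outside u∉) leaf₁        = spider u∉ (flip cl)
  fourth-colour u≢v cl leaf₂        (outside v∉) = spider₂ v∉ cl
  fourth-colour u≢v cl (outside u∉) leaf₂        = spider₂ u∉ (flip cl)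
  fourth-colour u≢v cl leaf₃        (outside v∉) = spider₃ v∉ cl
  fourth-colour u≢v cl (outside u∉) leaf₃        = spider₃ u∉ (flip cl)
  fourth-colour u≢v cl (outside u∉) (outside v∉) = claw+edge u∉ v∉ u≢v cl

  claw⇒pineapple : ∀ {y x z w} → y ≢ x → y ≢ z → y ≢ w → Unique (χ y x ∷ χ y z ∷ χ y w ∷ []) → Goal
  claw⇒pineapple {y} {x} {z} {w} y≢x y≢z y≢w three! with l , l∉ ← fresh (χ y x ∷ χ y z ∷ χ y w ∷ []) ≤-refl
    with u , v , u≢v , refl ← EdgeColoring.exact c l =
    fourth-colour u≢v (claw y≢x y≢z y≢w (Unique.++⁺ three! ([] ∷ []) λ { (∈₁ , here refl) → l∉ ∈₁ }))
      (position y x z w u) (position y x z w v)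

-- Rainbow paths as copies of P₅, and the upper bound.

path-edge : ∀ {m} (u v : Fin (suc m)) → suc (toℕ u) ≡ toℕ v → ∃ λ i → u ≡ inject₁ i × v ≡ suc i
path-edge {suc m} zero    (suc zero)    eq = zero , refl , refl
path-edge {suc m} (suc u) (suc v) eq with i , refl , refl ← path-edge u v (cong pred eq) = suc i , refl , refl

module _ {n : ℕ} (c : EdgeColoring (K n) 4) where

  private
    χ = color c
    χ-sym = EdgeColoring.sym c

  RainbowPath : (u v w x y : Fin n) → Set
  RainbowPath u v w x y = Unique (u ∷ v ∷ w ∷ x ∷ y ∷ []) × Unique (χ u v ∷ χ v w ∷ χ w x ∷ χ x y ∷ [])

  -- Each edge of the path has an index in the list of four colours. As these are distinct, equal
  -- colours give equal indices, hence the same unordered pair.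
  rainbow-copy : ∀ {u v w x y} → RainbowPath u v w x y → ∃ (Rainbow {G = P 5} c)
  rainbow-copy {u} {v} {w} {x} {y} (path! , colours!) = φ , rainbow
    where
    path = u ∷ v ∷ w ∷ x ∷ y ∷ []
    colours = χ u v ∷ χ v w ∷ χ w x ∷ χ x y ∷ []

    φ : Copy (P 5) (K n)
    φ = record
      { vertex    = lookup path
      ; injective = lookup-injective path!
      ; edge      = λ adj eq → irrefl (P 5) (lookup-injective path! eq) adj
      }
      where open Graph

    step : ∀ i → χ (lookup path (inject₁ i)) (lookup path (suc i)) ≡ lookup colours i
    step 0F = refl
    step 1F = refl
    step 2F = refl
    step 3F = refl

    index : ∀ {a b} → Adj (P 5) a b → ∃ λ i → χ (lookup path a) (lookup path b) ≡ lookup colours i ×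
      ((a ≡ inject₁ i × b ≡ suc i) ⊎ (b ≡ inject₁ i × a ≡ suc i))
    index {a} {b} (inj₁ eq) with i , refl , refl ← path-edge a b eq = i , step i , inj₁ (refl , refl)
    index {a} {b} (inj₂ eq) with i , refl , refl ← path-edge b a eq = i , trans (χ-sym _ _) (step i) , inj₂ (refl , refl)

    rainbow : Rainbow c φ
    rainbow ab a′b′ eq with index ab | index a′b′
    ... | i , p , q | j , p′ , q′ with refl ← lookup-injective colours! {i} {j} (trans (sym p) (trans eq p′)) with q | q′
    ... | inj₁ (refl , refl) | inj₁ (refl , refl) = inj₁ (refl , refl)
    ... | inj₁ (refl , refl) | inj₂ (refl , refl) = inj₂ (refl , refl)
    ... | inj₂ (refl , refl) | inj₁ (refl , refl) = inj₂ (refl , refl)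
    ... | inj₂ (refl , refl) | inj₂ (refl , refl) = inj₁ (refl , refl)

  -- Deciding this and the existence of a claw by finite search makes the case distinction of the
  -- upper bound constructive.
  rainbowPath? : Dec (∃₂ λ u v → ∃₂ λ w x → ∃ λ y → RainbowPath u v w x y)
  rainbowPath? = any? λ u → any? λ v → any? λ w → any? λ x → any? λ y → unique? _≟_ _ ×-dec unique? _≟_ _

  claw? : Dec (∃₂ λ y x → ∃₂ λ z w → y ≢ x × y ≢ z × y ≢ w × Unique (χ y x ∷ χ y z ∷ χ y w ∷ []))
  claw? = any? λ y → any? λ x → any? λ z → any? λ w →
    ¬? (y ≟ x) ×-dec ¬? (y ≟ z) ×-dec ¬? (y ≟ w) ×-dec unique? _≟_ _

  upper-bound : ∀ {s} → 7 ≤ s → suc (4 * s) ≤ n →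
    ∃ (Rainbow {G = P 5} c) ⊎ ∃ (Monochromatic {G = PA (suc s) 5} c)
  upper-bound {s} 7≤s large = cases rainbowPath? claw?
    where
    cases : Dec _ → Dec _ → ∃ (Rainbow {G = P 5} c) ⊎ ∃ (Monochromatic {G = PA (suc s) 5} c)
    cases (yes (_ , _ , _ , _ , _ , path)) _ = inj₁ (rainbow-copy path)
    cases (no none) (yes (_ , _ , _ , _ , y≢x , y≢z , y≢w , colours!)) =
      inj₂ (WithClaw.claw⇒pineapple c 7≤s large (λ p q → none (_ , _ , _ , _ , _ , p , q)) y≢x y≢z y≢w colours!)
    cases (no _) (no none) = inj₂ (NoClaw.no-claw⇒pineapple c 7≤s large
      λ { (_ , y≢x , refl) (_ , y≢z , refl) (_ , y≢w , refl) three! → none (_ , _ , _ , _ , y≢x , y≢z , y≢w , three!) })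

-- The extremal colouring

module BlockColouring {n s : ℕ} (block : Fin n → Fin 4) (offset : Fin n → Fin s)
  (coordinates-injective : ∀ {u v} → block u ≡ block v → offset u ≡ offset v → u ≡ v)
  (at : Fin 4 → Fin s → Fin n) (block-at : ∀ b j → block (at b j) ≡ b) (offset-at : ∀ b j → offset (at b j) ≡ j)
  (j₀ j₁ : Fin s) (j₀≢j₁ : j₀ ≢ j₁) where

  -- Colour 0 is reserved for edges between blocks, so blocks 0 and 1 share colour 1.
  palette : Fin 4 → Fin 4
  palette zero    = 1F
  palette (suc b) = suc b

  palette-≢0 : ∀ b → palette b ≢ 0F
  palette-≢0 zero    ()
  palette-≢0 (suc b) ()

  χ : Fin n → Fin n → Fin 4
  χ u v with block u ≟ block v
  ... | yes _ = palette (block u)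
  ... | no _  = 0F

  χ-within : ∀ {u v} → block u ≡ block v → χ u v ≡ palette (block u)
  χ-within {u} {v} eq with block u ≟ block v
  ... | yes _ = refl
  ... | no ≢  = contradiction eq ≢

  χ-across : ∀ {u v} → block u ≢ block v → χ u v ≡ 0F
  χ-across {u} {v} ≢ with block u ≟ block v
  ... | yes eq = contradiction eq ≢
  ... | no _   = refl

  χ-sym : ∀ u v → χ u v ≡ χ v u
  χ-sym u v with block u ≟ block v
  ... | yes eq = trans (cong palette eq) (sym (χ-within (sym eq)))
  ... | no ≢   = sym (χ-across (≢-sym ≢))

  χ-≢0 : ∀ {u v} → χ u v ≢ 0F → block u ≡ block v
  χ-≢0 {u} {v} ≢0 with block u ≟ block v
  ... | yes eq = eq
  ... | no ≢   = contradiction refl ≢0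

  colour-block : ∀ b → ∃₂ λ u v → u ≢ v × χ u v ≡ palette b
  colour-block b = at b j₀ , at b j₁ ,
    (λ eq → j₀≢j₁ (trans (sym (offset-at b j₀)) (trans (cong offset eq) (offset-at b j₁)))) ,
    trans (χ-within (trans (block-at b j₀) (sym (block-at b j₁)))) (cong palette (block-at b j₀))

  colouring : EdgeColoring (K n) 4
  colouring = record
    { color = χ
    ; sym   = χ-sym
    ; exact = λ where
        zero    → at 0F j₀ , at 1F j₀ , different ∘ cong block , χ-across different
        (suc b) → colour-block (suc b)
    }
    where
    different : block (at 0F j₀) ≢ block (at 1F j₀)
    different eq with trans (sym (block-at 0F j₀)) (trans eq (block-at 1F j₀))
    ... | ()

  -- Two adjacent edges that both avoid colour 0 stay inside one block and have its colour.
  some-0 : ∀ {u v w} → χ u v ≢ χ v w → χ u v ≡ 0F ⊎ χ v w ≡ 0F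
  some-0 {u} {v} {w} ≢ with χ u v ≟ 0F | χ v w ≟ 0F
  ... | yes p | _     = inj₁ p
  ... | no _  | yes q = inj₂ q
  ... | no p  | no q  = contradiction
    (trans (χ-within (χ-≢0 p)) (trans (cong palette (χ-≢0 p)) (sym (χ-within (χ-≢0 q))))) ≢

  -- One of the first two edges of the path and one of the last two would have colour 0.
  no-rainbow : ¬ ∃ (Rainbow {G = P 5} colouring)
  no-rainbow (φ , rainbow) = clash (some-0 λ eq → e₀≢e₁ (rainbow e₀ e₁ eq)) (some-0 λ eq → e₂≢e₃ (rainbow e₂ e₃ eq))
    where
    e₀ : Adj (P 5) 0F 1F
    e₀ = inj₁ refl
    e₁ : Adj (P 5) 1F 2F
    e₁ = inj₁ refl
    e₂ : Adj (P 5) 2F 3F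
    e₂ = inj₁ refl
    e₃ : Adj (P 5) 3F 4F
    e₃ = inj₁ refl

    e₀≢e₁ : ¬ ((0F ≡ 1F × 1F ≡ 2F) ⊎ (0F ≡ 2F × 1F ≡ 1F))
    e₀≢e₁ (inj₁ (() , _))
    e₀≢e₁ (inj₂ (() , _))

    e₂≢e₃ : ¬ ((2F ≡ 3F × 3F ≡ 4F) ⊎ (2F ≡ 4F × 3F ≡ 3F))
    e₂≢e₃ (inj₁ (() , _))
    e₂≢e₃ (inj₂ (() , _))

    f = vertex φ

    clash : χ (f 0F) (f 1F) ≡ 0F ⊎ χ (f 1F) (f 2F) ≡ 0F → ¬ (χ (f 2F) (f 3F) ≡ 0F ⊎ χ (f 3F) (f 4F) ≡ 0F)
    clash (inj₁ p) (inj₁ q) with rainbow e₀ e₂ (trans p (sym q))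
    ... | inj₁ (() , _)
    ... | inj₂ (() , _)
    clash (inj₁ p) (inj₂ q) with rainbow e₀ e₃ (trans p (sym q))
    ... | inj₁ (() , _)
    ... | inj₂ (() , _)
    clash (inj₂ p) (inj₁ q) with rainbow e₁ e₂ (trans p (sym q))
    ... | inj₁ (() , _)
    ... | inj₂ (() , _)
    clash (inj₂ p) (inj₂ q) with rainbow e₁ e₃ (trans p (sym q))
    ... | inj₁ (() , _)
    ... | inj₂ (() , _)

  -- In colour 0, two of the five clique vertices share one of the four blocks. In any other colour
  -- the whole pineapple lies in the block of its hub, where `s` offsets cannot hold `suc s`
  -- vertices.
  no-pineapple : 5 ≤ suc s → ¬ ∃ (Monochromatic {G = PA (suc s) 5} colouring)
  no-pineapple 5≤ (φ , i , mono) with i ≟ 0F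
  ... | yes refl = colliding (pigeonhole ≤-refl (block ∘ vertex φ ∘ λ j → inject≤ j 5≤))
    where
    colliding : ¬ ∃₂ λ j k → toℕ j < toℕ k × block (vertex φ (inject≤ j 5≤)) ≡ block (vertex φ (inject≤ k 5≤))
    colliding (j , k , j<k , eq) = palette-≢0 _ (trans (sym (χ-within eq))
      (mono ((λ eq → <⇒≢ᶠ j<k (inject≤-injective 5≤ 5≤ j k eq)) , inj₁ (below j , below k))))
      where
      below : ∀ (j : Fin 5) → toℕ (inject≤ j 5≤) < 5
      below j = subst (_< 5) (sym (toℕ-inject≤ j 5≤)) (toℕ<n j)
  ... | no i≢0 = colliding (pigeonhole ≤-refl (offset ∘ vertex φ))
    where
    hub-block : ∀ a → block (vertex φ 0F) ≡ block (vertex φ a)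
    hub-block zero    = refl
    hub-block (suc a) = χ-≢0 λ eq → i≢0 (trans (sym (mono ((λ ()) , inj₂ (inj₁ refl)))) eq)

    colliding : ¬ ∃₂ λ a b → toℕ a < toℕ b × offset (vertex φ a) ≡ offset (vertex φ b)
    colliding (a , b , a<b , eq) = <⇒≢ᶠ a<b (Copy.injective φ
      (coordinates-injective (trans (sym (hub-block a)) (hub-block b)) eq))

-- The value of the Gallai-Ramsey number.

n≤[1+n]C2 : ∀ n → n ≤ suc n C 2
n≤[1+n]C2 n = ≤-trans (≤-trans (≤-reflexive (sym (nC1≡n n))) (m≤m+n (n C 1) (n C 2)))
  (≤-reflexive (nCk+nC[k+1]≡[n+1]C[k+1] n 1))

4[1+s]∸3 : ∀ s → 4 * suc s ∸ 3 ≡ suc (4 * s)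
4[1+s]∸3 s = cong (_∸ 3) (*-suc 4 s)

theorem4p2 : (t : ℕ) → 8 ≤ t → IsGallaiRamseyNumber 4 (P 5) (PA t 5) (4 * t ∸ 3)
theorem4p2 (suc s) (s≤s 7≤s) = subst (IsGallaiRamseyNumber 4 (P 5) (PA (suc s) 5)) (sym (4[1+s]∸3 s))
  -- Here 4 ≤ 4 + 24 = 4 · 7 ≤ 4s, and 4s is at most the number of edges on 4s + 1 vertices.
  ( ( ≤-trans (≤-trans (m≤m+n 4 24) (*-monoʳ-≤ 4 7≤s)) (n≤[1+n]C2 (4 * s))
    , λ n n≥ c → upper-bound c 7≤s n≥ )
  , minimal 7≤s )
  where
  minimal : ∀ {s} → 7 ≤ s → ∀ M → GallaiRamseyBound 4 (P 5) (PA (suc s) 5) M → suc (4 * s) ≤ M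
  minimal {suc zero} (s≤s ())
  -- The form 2 + r supplies two distinct offsets, so that every block contains an edge.
  minimal {suc (suc r)} 7≤s M (_ , bound) = ≮⇒≥ λ M< →
    -- A bound M ≤ 4s would apply to n = 4s, where the block colouring contradicts it.
    [ no-rainbow , no-pineapple (s≤s (≤-trans (m≤m+n 4 3) 7≤s)) ]′ (bound (4 * (2 + r)) (≤-pred M<) colouring)
    where
    s′ = 2 + r

    coordinates-injective : ∀ {u v : Fin (4 * s′)} → quotient {4} s′ u ≡ quotient {4} s′ v →
      remainder {4} s′ u ≡ remainder {4} s′ v → u ≡ v
    coordinates-injective {u} {v} p q =
      trans (sym (combine-remQuot {4} s′ u)) (trans (cong₂ combine p q) (combine-remQuot {4} s′ v))

    open BlockColouring (quotient {4} s′) (remainder {4} s′) coordinates-injective combine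
      (λ b j → cong proj₁ (remQuot-combine {4} {s′} b j)) (λ b j → cong proj₂ (remQuot-combine {4} {s′} b j))
      0F 1F (λ ())
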